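{- Let $t\ge 3$ and $n$ be integers with $4^t\le n$. Then \[ s(m,n,t)\ge \frac{1}{15}\, m^{\frac{1}{t-1}\left(1-\frac{4^t}{n}\right)}. \]
   Context: Let $[m]=\{1,\dots,m\}$. An $(m,n,s)$-storing scheme is a map $\phi$ from the family of subsets of $[m]$ of size at most $n$ to $\{0,1\}^s$. An $(m,s,t)$-query scheme is a family $\{T_u\}_{u\in[m]}$ of Boolean decision trees of depth at most $t$ whose internal nodes are marked with addresses in $\{1,\dots,s\}$ (outgoing edges labelled $0$ and $1$; probes may be adaptive) and whose leaves are marked Yes/No. An $(m,n,s,t)$-scheme is a pair $(\phi,\{T_u\})$ such that for every $S\subseteq[m]$ with $|S|\le n$ and every $u\in[m]$, $T_u(\phi(S))=\mathrm{Yes}$ iff $u\in S$. $s(m,n,t)$ is the minimum $s$ for which an $(m,n,s,t)$-scheme exists. -}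

module Defs where

open import Data.Nat using (ℕ; suc; _⊔_; _≤_)
open import Data.Bool using (Bool; true; false; if_then_else_)
open import Data.Fin using (Fin)
open import Data.Fin.Subset using (Subset; _∈_; ∣_∣)
open import Relation.Binary.PropositionalEquality using (_≡_)
open import Function.Bundles using (_⇔_)

BitString : ℕ → Set
BitString s = Fin s → Bool

data DTree (s : ℕ) : Set where
  leaf : Bool → DTree s
  node : Fin s → DTree s → DTree s → DTree s

depth : ∀ {s} → DTree s → ℕ
depth (leaf _)       = 0
depth (node _ t₀ t₁) = suc (depth t₀ ⊔ depth t₁)

eval : ∀ {s} → DTree s → BitString s → Bool
eval (leaf b)       x = b
eval (node i t₀ t₁) x = if x i then eval t₁ x else eval t₀ x

StoringScheme : ℕ → ℕ → ℕ → Set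
StoringScheme m n s = (S : Subset m) → ∣ S ∣ ≤ n → BitString s

record QueryScheme (m s t : ℕ) : Set where
  field
    tree      : Fin m → DTree s
    depth-≤   : ∀ u → depth (tree u) ≤ t

IsScheme : ∀ {m n s t} → StoringScheme m n s → QueryScheme m s t → Set
IsScheme {m} {n} φ Q =
  (S : Subset m) (h : ∣ S ∣ ≤ n) (u : Fin m) →
  (eval (QueryScheme.tree Q u) (φ S h) ≡ true) ⇔ (u ∈ S)

{-# OPTIONS --safe #-}

-- A partial assignment of answers to queries that no memory satisfies rules out a scheme, since the
-- elements answered Yes form a set to be stored.  Small unsatisfiable assignments are found as follows.
-- Depth t: at least m/s trees have the same root r; one half of them refutes the value 0 of r through
-- the left subtrees, the other half refutes the value 1 through the right subtrees.
-- Depth 2: two trees with the same child y, given opposite demands on y, cannot both reach y, which is a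
-- 2-clause on their roots.  When every child is shared by more than g trees, the implications of
-- these clauses spread from any root literal by a factor g per step, so after k steps with g^k > s two
-- of them collide and the literal is refuted with O(k) queries.  Grouping the trees into quadruples with
-- a common root provides separate trees for the two refuted values of the root and, within each, for
-- the two sides of a tree.  Choosing k = n / 4^t and g ≈ s^(1/k) gives the bound.
module Submission where

open import Defs
open import Algebra.Properties.CommutativeMonoid.Sum using ()
open import Data.Bool using (Bool; true; false; not; _∧_; _∨_; if_then_else_)
open import Data.Bool.Properties using (not-¬; ¬-not; not-injective; not-involutive) renaming (_≟_ to _≟ᵇ_)
open import Data.Empty using (⊥; ⊥-elim)
open import Data.Fin using (Fin; zero; suc; _≟_; combine)
open import Data.Fin.Properties using (any?; combine-injective; suc-injective)
open import Data.Fin.Subset using (Subset; ⁅_⁆; _∪_; ∣_∣) renaming (⊥ to ∅; _∈_ to _∈ₛ_)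
open import Data.Fin.Subset.Properties using (x∈⁅x⁆; x∈⁅y⁆⇒x≡y; ∣⁅x⁆∣≡1; x∈p∪q⁻; x∈p∪q⁺; ∉⊥; ∣⊥∣≡0)
open import Data.List using (List; []; _∷_; _++_; length; map; allFin; cartesianProduct)
open import Data.List.Membership.Propositional using (_∈_; find; lose)
open import Data.List.Membership.Propositional.Properties
  using (∈-∃++; ∈-++⁺ˡ; ∈-++⁺ʳ; ∈-++⁻; ∈-map⁻; ∈-allFin; ∈-cartesianProduct⁺)
open import Data.List.Properties using (length-++; length-map; length-tabulate)
open import Data.List.Relation.Unary.All using (All; []; _∷_)
import Data.List.Relation.Unary.All as All
import Data.List.Relation.Unary.All.Properties as All
open import Data.List.Relation.Unary.Any using (here; there)
import Data.List.Relation.Unary.Any as Any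
open import Data.Nat using (ℕ; zero; suc; pred; _+_; _*_; _∸_; _^_; _≤_; _<_; z≤n; s≤s; _<?_; _≤?_; _/_; _%_; NonZero; >-nonZero; ≢-nonZero)
open import Data.Nat.DivMod using (m≡m%n+[m/n]*n; m%n≤n; m/n*n≤m; m≥n⇒m/n>0)
open import Data.Nat.Properties hiding (_≟_; suc-injective)
open import Data.Nat.Solver using (module +-*-Solver)
open import Data.Product using (∃-syntax; Σ-syntax; ∃₂; _×_; _,_; proj₁; proj₂; map₁)
open import Data.Sum using (_⊎_; inj₁; inj₂)
open import Data.Unit using (⊤; tt)
open import Data.Vec using ([]; _∷_)
open import Function using (_∘_; id; Injective)
open import Function.Bundles using (module Equivalence)
open import Relation.Binary.PropositionalEquality
  using (_≡_; _≢_; refl; sym; trans; cong; cong₂; subst; module ≡-Reasoning)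
open import Relation.Nullary using (¬_; ¬?; Dec; yes; no; contradiction; ⌊_⌋; _×-dec_)

open Algebra.Properties.CommutativeMonoid.Sum +-0-commutativeMonoid
  using (sum; sum-cong-≗; sum-replicate-zero; ∑-distrib-+; ∑-comm)

private
  variable
    m n s : ℕ

-- Counting over finite index sets.

sum-mono-≤ : (f g : Fin n → ℕ) → (∀ i → f i ≤ g i) → sum f ≤ sum g
sum-mono-≤ {zero}  f g h = z≤n
sum-mono-≤ {suc n} f g h = +-mono-≤ (h zero) (sum-mono-≤ (f ∘ suc) (g ∘ suc) (h ∘ suc))

sum-const : ∀ n k → sum {n} (λ _ → k) ≡ n * k
sum-const zero    k = refl
sum-const (suc n) k = cong (k +_) (sum-const n k)

*-distribˡ-sum : ∀ k (f : Fin n → ℕ) → k * sum f ≡ sum (λ i → k * f i)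
*-distribˡ-sum {zero}  k f = *-zeroʳ k
*-distribˡ-sum {suc n} k f =
  trans (*-distribˡ-+ k (f zero) _) (cong (k * f zero +_) (*-distribˡ-sum k (f ∘ suc)))

bit : Bool → ℕ
bit true  = 1
bit false = 0

count : (Fin n → Bool) → ℕ
count A = sum (bit ∘ A)

fiber : (Fin n → Bool) → (Fin n → Fin s) → Fin s → Fin n → Bool
fiber A κ y i = A i ∧ ⌊ κ i ≟ y ⌋

∧-true⁻ : ∀ a b → a ∧ b ≡ true → a ≡ true × b ≡ true
∧-true⁻ true true _ = refl , refl

⌊⌋-true⁻ : ∀ {P : Set} (P? : Dec P) → ⌊ P? ⌋ ≡ true → P
⌊⌋-true⁻ (yes p) _ = p

⌊⌋-true⁺ : ∀ {P : Set} (P? : Dec P) → P → ⌊ P? ⌋ ≡ true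
⌊⌋-true⁺ (yes _) _ = refl
⌊⌋-true⁺ (no ¬p) p = contradiction p ¬p

fiber⁻ : (A : Fin n → Bool) (κ : Fin n → Fin s) → ∀ y i → fiber A κ y i ≡ true → A i ≡ true × κ i ≡ y
fiber⁻ A κ y i h with ∧-true⁻ (A i) _ h
... | a , e = a , ⌊⌋-true⁻ (κ i ≟ y) e

fiber⁺ : (A : Fin n → Bool) (κ : Fin n → Fin s) → ∀ y i → A i ≡ true → κ i ≡ y → fiber A κ y i ≡ true
fiber⁺ A κ y i a e rewrite a = ⌊⌋-true⁺ (κ i ≟ y) e

bit-mono : ∀ a b → (a ≡ true → b ≡ true) → bit a ≤ bit b
bit-mono false b h = z≤n
bit-mono true  b h rewrite h refl = ≤-refl

count-mono : (A B : Fin n → Bool) → (∀ i → A i ≡ true → B i ≡ true) → count A ≤ count B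
count-mono A B h = sum-mono-≤ _ _ (λ i → bit-mono (A i) (B i) (h i))

count-≤-+ : (A B C : Fin n → Bool) → (∀ i → A i ≡ true → B i ≡ true ⊎ C i ≡ true) →
            count A ≤ count B + count C
count-≤-+ A B C h = ≤-trans (sum-mono-≤ _ _ (λ i → pointwise (A i) (B i) (C i) (h i)))
                            (≤-reflexive (∑-distrib-+ (bit ∘ B) (bit ∘ C)))
  where
  pointwise : ∀ a b c → (a ≡ true → b ≡ true ⊎ c ≡ true) → bit a ≤ bit b + bit c
  pointwise false b c h = z≤n
  pointwise true  b c h with h refl
  ... | inj₁ refl = s≤s z≤n
  ... | inj₂ refl = m≤n+m 1 (bit b)

sum-delta : ∀ a (k : Fin s) → sum (λ y → bit (a ∧ ⌊ k ≟ y ⌋)) ≡ bit a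
sum-delta {s} false k = sum-replicate-zero s
sum-delta {suc s} true zero    = cong suc (sum-replicate-zero s)
sum-delta {suc s} true (suc k) = trans (sum-cong-≗ (λ y → cong bit (same y))) (sum-delta true k)
  where
  same : ∀ y → ⌊ suc k ≟ suc y ⌋ ≡ ⌊ k ≟ y ⌋
  same y with k ≟ y
  ... | yes _ = refl
  ... | no  _ = refl

count-fibers : (A : Fin n → Bool) (κ : Fin n → Fin s) → count A ≡ sum (λ y → count (fiber A κ y))
count-fibers A κ = trans (sum-cong-≗ (λ i → sym (sum-delta (A i) (κ i))))
                         (∑-comm (λ i y → bit (fiber A κ y i)))

-- Pigeonhole arguments and greedy pairing.

enumerate : ∀ k (A : Fin n → Bool) → k ≤ count A →
            Σ[ e ∈ (Fin k → Fin n) ] Injective _≡_ _≡_ e × (∀ i → A (e i) ≡ true)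
enumerate zero A h = (λ ()) , (λ { {()} }) , λ ()
enumerate {suc n} (suc k) A h with A zero in A0
... | false with enumerate (suc k) (A ∘ suc) h
...   | e , inj , ok = suc ∘ e , inj ∘ suc-injective , ok
enumerate {suc n} (suc k) A (s≤s h) | true with enumerate k (A ∘ suc) h
...   | e , inj , ok = e′ , inj′ , ok′
  where
  e′ : Fin (suc k) → Fin (suc n)
  e′ zero    = zero
  e′ (suc i) = suc (e i)
  inj′ : Injective _≡_ _≡_ e′
  inj′ {zero}  {zero}  _  = refl
  inj′ {suc i} {suc j} eq = cong suc (inj (suc-injective eq))
  ok′ : ∀ i → A (e′ i) ≡ true
  ok′ zero    = A0
  ok′ (suc i) = ok i

large-fiber : ∀ k (A : Fin n → Bool) (κ : Fin n → Fin s) → .{{NonZero s}} →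
              s * k ≤ count A → ∃[ y ] k ≤ count (fiber A κ y)
large-fiber {s = suc s} zero A κ h = zero , z≤n
large-fiber {s = suc s} (suc k) A κ h with any? (λ y → suc k ≤? count (fiber A κ y))
... | yes found = found
... | no  none  = contradiction h (<⇒≱ (begin-strict
  count A                              ≡⟨ count-fibers A κ ⟩
  sum (λ y → count (fiber A κ y))      ≤⟨ sum-mono-≤ _ (λ _ → k) (λ y → ≤-pred (≰⇒> (λ le → none (y , le)))) ⟩
  sum {suc s} (λ _ → k)                ≡⟨ sum-const (suc s) k ⟩
  suc s * k                            <⟨ *-monoʳ-< (suc s) (n<1+n k) ⟩
  suc s * suc k                        ∎))
  where open ≤-Reasoning

Collision : (Fin n → Bool) → (Fin n → Fin s) → Set
Collision A κ = ∃₂ λ p q → p ≢ q × A p ≡ true × A q ≡ true × κ p ≡ κ q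

collision? : (A : Fin n → Bool) (κ : Fin n → Fin s) → Dec (Collision A κ)
collision? A κ = any? λ p → any? λ q →
  ¬? (p ≟ q) ×-dec (A p ≟ᵇ true) ×-dec (A q ≟ᵇ true) ×-dec (κ p ≟ κ q)

small-fibers : (A : Fin n → Bool) (κ : Fin n → Fin s) → ¬ Collision A κ →
               ∀ y → count (fiber A κ y) ≤ 1
small-fibers A κ none y with 2 ≤? count (fiber A κ y)
... | no  small = ≤-pred (≰⇒> small)
... | yes large with enumerate 2 (fiber A κ y) large
...   | e , inj , ok =
  contradiction (e zero , e (suc zero) , (λ eq → contradiction (inj eq) λ ()) ,
                 proj₁ f₀ , proj₁ f₁ , trans (proj₂ f₀) (sym (proj₂ f₁))) none
  where
  f₀ = fiber⁻ A κ y _ (ok zero)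
  f₁ = fiber⁻ A κ y _ (ok (suc zero))

no-collision⇒count≤ : (A : Fin n → Bool) (κ : Fin n → Fin s) → ¬ Collision A κ → count A ≤ s
no-collision⇒count≤ {s = s} A κ none = begin
  count A                          ≡⟨ count-fibers A κ ⟩
  sum (λ y → count (fiber A κ y))  ≤⟨ sum-mono-≤ _ (λ _ → 1) (small-fibers A κ none) ⟩
  sum {s} (λ _ → 1)                ≡⟨ sum-const s 1 ⟩
  s * 1                            ≡⟨ *-identityʳ s ⟩
  s                                ∎
  where open ≤-Reasoning

count-true : ∀ n → count {n} (λ _ → true) ≡ n
count-true n = trans (sum-const n 1) (*-identityʳ n)

-- With `I = Bool`, both families `e true` and `e false` are injective and their images are
-- disjoint, so two refutations placed on them share no query.
JointlyInjective : {I J K : Set} → (I → J → K) → Set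
JointlyInjective e = ∀ i i′ j j′ → e i j ≡ e i′ j′ → i ≡ i′ × j ≡ j′

_─_ : (Fin n → Bool) → Fin n → Fin n → Bool
(A ─ p) i = A i ∧ not ⌊ p ≟ i ⌋

─⁻ : (A : Fin n → Bool) (p : Fin n) → ∀ i → (A ─ p) i ≡ true → A i ≡ true × p ≢ i
─⁻ A p i h with A i | p ≟ i
... | true | no p≢i = refl , p≢i

count-─ : (A : Fin n → Bool) (p : Fin n) → count A ≤ suc (count (A ─ p))
count-─ A p = begin
  count A                                    ≤⟨ count-≤-+ A (λ i → ⌊ p ≟ i ⌋) (A ─ p) split ⟩
  count (λ i → ⌊ p ≟ i ⌋) + count (A ─ p)    ≡⟨ cong (_+ count (A ─ p)) (sum-delta true p) ⟩
  suc (count (A ─ p))                        ∎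
  where
  open ≤-Reasoning
  split : ∀ i → A i ≡ true → ⌊ p ≟ i ⌋ ≡ true ⊎ (A ─ p) i ≡ true
  split i a with p ≟ i
  ... | yes _ = inj₁ refl
  ... | no  _ rewrite a = inj₂ refl

-- Greedy choice: while more than `s` elements remain, two of them share a key, and removing them
-- costs two elements. The summand `s` is what may stay unpaired at the end.
pairs : ∀ k (A : Fin n → Bool) (κ : Fin n → Fin s) → s + (k + k) ≤ count A →
        Σ[ e ∈ (Bool → Fin k → Fin n) ]
          JointlyInjective e × (∀ b i → A (e b i) ≡ true) × (∀ b i → κ (e b i) ≡ κ (e true i))
pairs zero A κ h = (λ _ ()) , (λ _ _ ()) , (λ _ ()) , λ _ ()
pairs {n} {s} (suc k) A κ h with collision? A κ
... | no none = contradiction (≤-trans h (no-collision⇒count≤ A κ none))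
                                 (<⇒≱ (m<m+n s (s≤s z≤n)))
... | yes (p , q , p≢q , Ap , Aq , κpq) = e′ , inj′ , ok′ , key′
  where
  A′ = (A ─ p) ─ q
  room : s + (k + k) ≤ count A′
  room = ≤-pred (≤-pred (begin
    suc (suc (s + (k + k)))       ≡⟨ cong suc (sym (+-suc s (k + k))) ⟩
    suc (s + suc (k + k))         ≡⟨ sym (+-suc s (suc (k + k))) ⟩
    s + suc (suc (k + k))         ≡⟨ cong (λ z → s + suc z) (sym (+-suc k k)) ⟩
    s + (suc k + suc k)           ≤⟨ h ⟩
    count A                       ≤⟨ count-─ A p ⟩
    suc (count (A ─ p))           ≤⟨ s≤s (count-─ (A ─ p) q) ⟩
    suc (suc (count A′))          ∎))
    where open ≤-Reasoning
  rec = pairs k A′ κ room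
  e   = proj₁ rec
  avoid : ∀ b i → (A (e b i) ≡ true × p ≢ e b i) × q ≢ e b i
  avoid b i = let x , y = ─⁻ (A ─ p) q _ (proj₁ (proj₂ (proj₂ rec)) b i) in ─⁻ A p _ x , y
  new : Bool → Fin n
  new true  = p
  new false = q
  new≢ : ∀ c b i → new c ≢ e b i
  new≢ true  b i = proj₂ (proj₁ (avoid b i))
  new≢ false b i = proj₂ (avoid b i)
  e′ : Bool → Fin (suc k) → Fin n
  e′ b zero    = new b
  e′ b (suc i) = e b i
  inj′ : JointlyInjective e′
  inj′ true  true  zero    zero    _  = refl , refl
  inj′ false false zero    zero    _  = refl , refl
  inj′ true  false zero    zero    eq = contradiction eq p≢q
  inj′ false true  zero    zero    eq = contradiction (sym eq) p≢q
  inj′ b     b′    zero    (suc i) eq = contradiction eq (new≢ b b′ i)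
  inj′ b     b′    (suc i) zero    eq = contradiction (sym eq) (new≢ b′ b i)
  inj′ b     b′    (suc i) (suc j) eq =
    let x , y = proj₁ (proj₂ rec) b b′ i j eq in x , cong suc y
  ok′ : ∀ b i → A (e′ b i) ≡ true
  ok′ true  zero    = Ap
  ok′ false zero    = Aq
  ok′ b     (suc i) = proj₁ (proj₁ (avoid b i))
  key′ : ∀ b i → κ (e′ b i) ≡ κ (e′ true i)
  key′ true  zero    = refl
  key′ false zero    = sym κpq
  key′ b     (suc i) = proj₂ (proj₂ (proj₂ rec)) b i

-- Pruning to large minimum degree.

_∩_ : (Fin n → Bool) → (Fin n → Bool) → Fin n → Bool
(A ∩ B) i = A i ∧ B i

-- The vertices of degree at most g are deleted one by one, each time losing at most g of the A.
prune : {V : Set} (inc : V → Fin n → Bool) (g : ℕ) (k : ℕ) (vs : List V) → length vs ≡ k →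
        (A : Fin n → Bool) → k * g < count A →
        Σ[ P ∈ (Fin n → Bool) ]
          (∀ i → P i ≡ true → A i ≡ true) × (∃[ i ] P i ≡ true) ×
          (∀ v i → v ∈ vs → P i ≡ true → inc v i ≡ true → g < count (P ∩ inc v))
prune inc g k vs eqk A h with Any.any? (λ v → count (A ∩ inc v) ≤? g) vs
... | no none = A , (λ _ → id) , (let e , _ , ok = enumerate 1 A (≤-trans (s≤s z≤n) h) in e zero , ok zero) ,
                λ v i v∈ _ _ → ≰⇒> λ le → none (lose v∈ le)
... | yes some with find some
...   | v , v∈ , le with ∈-∃++ v∈
...     | xs , ys , refl with k
...       | zero  = contradiction (trans (sym (length-++ xs)) eqk) (λ e → contradiction (m+n≡0⇒n≡0 (length xs) e) λ ())
...       | suc k = P , (λ i → proj₁ ∘ A′⁻ i ∘ P⊆ i) , ne , deg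
  where
  A′ : Fin _ → Bool
  A′ i = A i ∧ not (inc v i)
  A′⁻ : ∀ i → A′ i ≡ true → A i ≡ true × inc v i ≢ true
  A′⁻ i h with A i | inc v i
  ... | true | false = refl , λ ()
  split : ∀ i → A i ≡ true → (A ∩ inc v) i ≡ true ⊎ A′ i ≡ true
  split i a with inc v i
  ... | true  rewrite a = inj₁ refl
  ... | false rewrite a = inj₂ refl
  len : length (xs ++ ys) ≡ k
  len = cong pred (begin
    suc (length (xs ++ ys))         ≡⟨ cong suc (length-++ xs) ⟩
    suc (length xs + length ys)     ≡⟨ sym (+-suc _ _) ⟩
    length xs + length (v ∷ ys)     ≡⟨ sym (length-++ xs) ⟩
    length (xs ++ v ∷ ys)           ≡⟨ eqk ⟩
    suc k                           ∎)
    where open ≡-Reasoning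
  room : k * g < count A′
  room = +-cancelˡ-< g _ _ (begin-strict
    g + k * g                       <⟨ h ⟩
    count A                         ≤⟨ count-≤-+ A (A ∩ inc v) A′ split ⟩
    count (A ∩ inc v) + count A′    ≤⟨ +-monoˡ-≤ _ le ⟩
    g + count A′                    ∎)
    where open ≤-Reasoning
  rec = prune inc g k (xs ++ ys) len A′ room
  P  = proj₁ rec
  P⊆ = proj₁ (proj₂ rec)
  ne = proj₁ (proj₂ (proj₂ rec))
  deg : ∀ w i → w ∈ xs ++ v ∷ ys → P i ≡ true → inc w i ≡ true → g < count (P ∩ inc w)
  deg w i w∈ Pi wi with ∈-++⁻ xs w∈
  ... | inj₁ w∈xs         = proj₂ (proj₂ (proj₂ rec)) w i (∈-++⁺ˡ w∈xs) Pi wi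
  ... | inj₂ (there w∈ys) = proj₂ (proj₂ (proj₂ rec)) w i (∈-++⁺ʳ xs w∈ys) Pi wi
  -- No surviving element is incident to the deleted vertex, so its degree condition is vacuous.
  ... | inj₂ (here refl)  = contradiction wi (proj₂ (A′⁻ i (P⊆ i Pi)))

-- Spreading forced root values in trees of depth two.

Functional : {I : Set} → List (I × Bool) → Set
Functional as = ∀ {u b b′} → (u , b) ∈ as → (u , b′) ∈ as → b ≡ b′

∨-true⁻ : ∀ a b → a ∨ b ≡ true → a ≡ true ⊎ b ≡ true
∨-true⁻ true  b _ = inj₁ refl
∨-true⁻ false b h = inj₂ h

false-or-true : ∀ b → b ≡ false ⊎ b ≡ true
false-or-true false = inj₁ refl
false-or-true true  = inj₂ refl

not-true⁻ : ∀ b → not b ≡ true → b ≡ false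
not-true⁻ false _ = refl

-- Without collisions `A` meets every fiber at most once, hence meets `count A` distinct fibers, and
-- each of these holds at least `d` elements of `B`.
fiber-growth : (A B : Fin n → Bool) (κ : Fin n → Fin s) (d : ℕ) → ¬ Collision A κ →
               (∀ p → A p ≡ true → d ≤ count (fiber B κ (κ p))) →
               d * count A ≤ count (λ q → B q ∧ ⌊ 1 ≤? count (fiber A κ (κ q)) ⌋)
fiber-growth A B κ d none deg = begin
  d * count A                            ≡⟨ cong (d *_) (count-fibers A κ) ⟩
  d * sum (λ y → count (fiber A κ y))    ≡⟨ *-distribˡ-sum d (λ y → count (fiber A κ y)) ⟩
  sum (λ y → d * count (fiber A κ y))    ≤⟨ sum-mono-≤ _ _ termwise ⟩
  sum (λ y → count (fiber T κ y))        ≡⟨ sym (count-fibers T κ) ⟩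
  count T                                ∎
  where
  open ≤-Reasoning
  T : Fin _ → Bool
  T q = B q ∧ ⌊ 1 ≤? count (fiber A κ (κ q)) ⌋
  termwise : ∀ y → d * count (fiber A κ y) ≤ count (fiber T κ y)
  termwise y with 1 ≤? count (fiber A κ y)
  ... | no  empty = ≤-trans (≤-reflexive (trans (cong (d *_) (n<1⇒n≡0 (≰⇒> empty))) (*-zeroʳ d))) z≤n
  ... | yes hit with enumerate 1 (fiber A κ y) hit
  ...   | e , _ , ok with fiber⁻ A κ y _ (ok zero)
  ...     | Ap , refl = begin
    d * count (fiber A κ y)  ≤⟨ *-monoʳ-≤ d (small-fibers A κ none y) ⟩
    d * 1                    ≡⟨ *-identityʳ d ⟩
    d                        ≤⟨ deg (e zero) Ap ⟩
    count (fiber B κ y)      ≤⟨ count-mono _ _ (λ q → promote q ∘ fiber⁻ B κ y q) ⟩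
    count (fiber T κ y)      ∎
    where
    promote : ∀ q → B q ≡ true × κ q ≡ y → fiber T κ y q ≡ true
    promote q (Bq , eq) = fiber⁺ T κ y q
      (trans (cong (_∧ _) Bq) (⌊⌋-true⁺ (1 ≤? _) (subst (λ z → 1 ≤ count (fiber A κ z)) (sym eq) hit))) eq

-- An index `p` stands for two trees with common root address `ρ p`; the one used on the edge `c`
-- probes `κ c p` there. The aim is to contradict the assumption that `r₀` holds `b₀`.
module Propagation
  (ρ : Fin n → Fin s) (κ : Bool → Fin n → Fin s) (P : Fin n → Bool) (g : ℕ)
  (deg : ∀ c p → P p ≡ true → g < count (fiber P (κ c) (κ c p)))
  (r₀ : Fin s) (b₀ : Bool)
  where

  -- ((c , p) , β) demands that the child of p for the root value c holds β.
  Entry : Set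
  Entry = (Bool × Fin n) × Bool

  -- An implication, because a tree whose root holds the other value never reads this child.
  Sat : BitString s → Entry → Set
  Sat x ((c , p) , β) = x (ρ p) ≡ c → x (κ c p) ≡ β

  Refuted : ℕ → Set
  Refuted k = Σ[ es ∈ List Entry ] length es ≤ k × Functional es ×
              (∀ x → x r₀ ≡ b₀ → ¬ All (Sat x) es)

  -- R c consists of the roots forced to the value c; O c of those whose consequences were drawn.
  -- A tree used on the c-side of a source root demands that its child is 1, on the c-side of a
  -- target root (to be forced to not c) that its child is 0.  As R c and R (not c) are disjoint,
  -- these demands are consistent across all derivations.
  data OK (R O : Bool → Fin s → Bool) : Entry → Set where
    source : ∀ {c p} → O c (ρ p) ≡ true       → OK R O ((c , p) , true)
    target : ∀ {c p} → R (not c) (ρ p) ≡ true → OK R O ((c , p) , false)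

  record Forced (R O : Bool → Fin s → Bool) (k : ℕ) (c : Bool) (r : Fin s) : Set where
    constructor forced
    field
      entries : List Entry
      size    : length entries ≤ k
      ok      : All (OK R O) entries
      forces  : ∀ x → x r₀ ≡ b₀ → All (Sat x) entries → x r ≡ c

  at : (Bool → Fin s → Bool) → Bool → Fin n → Bool
  at R c p = P p ∧ R c (ρ p)

  at⁻ : ∀ R c p → at R c p ≡ true → P p ≡ true × R c (ρ p) ≡ true
  at⁻ R c p = ∧-true⁻ (P p) (R c (ρ p))

  at⁺ : ∀ R c p → P p ≡ true → R c (ρ p) ≡ true → at R c p ≡ true
  at⁺ R c p a b rewrite a = b

  -- Invariant of the spreading process. By `closed`, any collision inside `R c` involves a source
  -- not yet in `O c`; by `disjoint`, no tree is both a source and a target; `k` bounds the length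
  -- of every derivation.
  record State (k : ℕ) : Set where
    field
      R O      : Bool → Fin s → Bool
      O⊆R      : ∀ c r → O c r ≡ true → R c r ≡ true
      disjoint : ∀ c r → R c r ≡ true → R (not c) r ≡ true → ⊥
      closed   : ∀ c → ¬ Collision (at O c) (κ c)
      derive   : ∀ c r → R c r ≡ true → Forced R O k c r

  module _ {k} (S : State k) where
    open State S

    -- Both roots are forced to `c`, so the shared child is demanded to be 0 through `p` and 1
    -- through `q`. The demand at `p` has the wrong polarity for a source, but as `ρ p` is outside
    -- `O c`, no derivation uses `p` as a source on the side `c`.
    collision⇒refuted′ : ∀ c p q → p ≢ q → O c (ρ p) ≢ true →
                         R c (ρ p) ≡ true → R c (ρ q) ≡ true → κ c p ≡ κ c q → Refuted (2 + (k + k))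
    collision⇒refuted′ c p q p≢q p∉O Rp Rq eq = es , size , functional , unsat
      where
      module Fp = Forced (derive c (ρ p) Rp)
      module Fq = Forced (derive c (ρ q) Rq)
      es = ((c , p) , false) ∷ ((c , q) , true) ∷ (Fp.entries ++ Fq.entries)
      size : length es ≤ 2 + (k + k)
      size = s≤s (s≤s (≤-trans (≤-reflexive (length-++ Fp.entries)) (+-mono-≤ Fp.size Fq.size)))
      data Good : Entry → Set where
        up : ∀ {c′ p′} → R c′ (ρ p′) ≡ true → (c′ , p′) ≢ (c , p) → Good ((c′ , p′) , true)
        down  : ∀ {c′ p′} → R (not c′) (ρ p′) ≡ true ⊎ (c′ , p′) ≡ (c , p) → Good ((c′ , p′) , false)
      OK⇒Good : ∀ {e} → OK R O e → Good e
      OK⇒Good (source o) = up (O⊆R _ _ o) (λ { refl → p∉O o })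
      OK⇒Good (target r) = down (inj₁ r)
      good : All Good es
      good = down (inj₂ refl) ∷ up Rq (λ { refl → p≢q refl }) ∷
             All.map OK⇒Good (All.++⁺ Fp.ok Fq.ok)
      agree : ∀ {u b b′} → Good (u , b) → Good (u , b′) → b ≡ b′
      agree (up _ _) (up _ _) = refl
      agree (down _)    (down _)    = refl
      agree (up r _) (down (inj₁ r′)) = ⊥-elim (disjoint _ _ r r′)
      agree (up _ d) (down (inj₂ e))  = contradiction e d
      agree (down (inj₁ r′)) (up r _) = ⊥-elim (disjoint _ _ r r′)
      agree (down (inj₂ e))  (up _ d) = contradiction e d
      functional : Functional es
      functional i j = agree (All.lookup good i) (All.lookup good j)
      unsat : ∀ x → x r₀ ≡ b₀ → ¬ All (Sat x) es
      unsat x x₀ (sp ∷ sq ∷ rest) with All.++⁻ Fp.entries rest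
      ... | restp , restq with trans (sym (sq (Fq.forces x x₀ restq)))
                                     (trans (cong x (sym eq)) (sp (Fp.forces x x₀ restp)))
      ...   | ()

    -- A source that is flipped to close the contradiction must not occur in the derivations, so it
    -- must not have been expanded yet; one of any two colliding sources qualifies.
    collision⇒refuted : ∀ c → Collision (at R c) (κ c) → Refuted (2 + (k + k))
    collision⇒refuted c (p , q , p≢q , ap , aq , eq)
      with at⁻ R c p ap | at⁻ R c q aq | O c (ρ p) ≟ᵇ true | O c (ρ q) ≟ᵇ true
    ... | Pp , Rp | Pq , Rq | no p∉O | _ = collision⇒refuted′ c p q p≢q p∉O Rp Rq eq
    ... | Pp , Rp | Pq , Rq | yes _  | no q∉O = collision⇒refuted′ c q p (p≢q ∘ sym) q∉O Rq Rp (sym eq)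
    ... | Pp , Rp | Pq , Rq | yes p∈O | yes q∈O =
      contradiction (p , q , p≢q , at⁺ O c p Pp p∈O , at⁺ O c q Pq q∈O , eq) (closed c)

    -- One round on the side `c`: a source `p` and a tree `q` with the same child exclude that both
    -- roots hold `c`, so `ρ q` must hold `not c`. Afterwards all of `R c` counts as expanded, and
    -- the next round works on the side `not c`.
    module Expand (c : Bool) (none : ¬ Collision (at R c) (κ c)) where

      reached : Fin n → Bool
      reached q = P q ∧ ⌊ 1 ≤? count (fiber (at R c) (κ c) (κ c q)) ⌋

      new : Fin s → Bool
      -- A reached tree with root in `R c` is itself a source; leaving these roots out keeps the two
      -- sides disjoint.
      new r = not (R c r) ∧ ⌊ any? (λ q → (reached q ≟ᵇ true) ×-dec (ρ q ≟ r)) ⌋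

      R′ O′ : Bool → Fin s → Bool
      R′ d r = R d r ∨ (⌊ d ≟ᵇ not c ⌋ ∧ new r)
      O′ d r = if ⌊ d ≟ᵇ c ⌋ then R c r else O d r

      R′⁻ : ∀ d r → R′ d r ≡ true →
            R d r ≡ true ⊎ (d ≡ not c × R c r ≡ false × ∃[ q ] reached q ≡ true × ρ q ≡ r)
      R′⁻ d r h with ∨-true⁻ (R d r) _ h
      ... | inj₁ old = inj₁ old
      ... | inj₂ h′ with ∧-true⁻ ⌊ d ≟ᵇ not c ⌋ _ h′
      ...   | d≡ , h″ with ∧-true⁻ (not (R c r)) _ h″
      ...     | nR , ex = inj₂ (⌊⌋-true⁻ (d ≟ᵇ not c) d≡ , not-true⁻ _ nR , ⌊⌋-true⁻ (any? _) ex)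

      R⊆R′ : ∀ d r → R d r ≡ true → R′ d r ≡ true
      R⊆R′ d r h rewrite h = refl

      R′-new : ∀ q → R c (ρ q) ≡ false → reached q ≡ true → R′ (not c) (ρ q) ≡ true
      R′-new q Rq t with R (not c) (ρ q)
      ... | true  = refl
      ... | false rewrite ⌊⌋-true⁺ (not c ≟ᵇ not c) refl | Rq =
        ⌊⌋-true⁺ (any? (λ q′ → (reached q′ ≟ᵇ true) ×-dec (ρ q′ ≟ ρ q))) (q , t , refl)

      O′⁻ : ∀ d r → O′ d r ≡ true → (d ≡ c × R c r ≡ true) ⊎ O d r ≡ true
      O′⁻ d r h with d ≟ᵇ c
      ... | yes d≡c = inj₁ (d≡c , h)
      ... | no  _   = inj₂ h

      O⊆O′ : ∀ d r → O d r ≡ true → O′ d r ≡ true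
      O⊆O′ d r h with d ≟ᵇ c
      ... | yes refl = O⊆R c r h
      ... | no  _    = h

      R⊆O′ : ∀ r → R c r ≡ true → O′ c r ≡ true
      R⊆O′ r h with c ≟ᵇ c
      ... | yes _   = h
      ... | no  c≢c = contradiction refl c≢c

      O′⊆R′ : ∀ d r → O′ d r ≡ true → R′ d r ≡ true
      O′⊆R′ d r h with O′⁻ d r h
      ... | inj₁ (refl , h′) = R⊆R′ c r h′
      ... | inj₂ h′          = R⊆R′ d r (O⊆R d r h′)

      disjoint′ : ∀ d r → R′ d r ≡ true → R′ (not d) r ≡ true → ⊥
      disjoint′ d r h₁ h₂ with R′⁻ d r h₁ | R′⁻ (not d) r h₂
      ... | inj₁ a | inj₁ b = disjoint d r a b
      ... | inj₁ a | inj₂ (e , f , _) with not-injective e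
      ...   | refl = contradiction (trans (sym a) f) λ ()
      disjoint′ d r h₁ h₂ | inj₂ (refl , f , _) | inj₁ b =
        contradiction (trans (sym b) (trans (cong (λ z → R z r) (not-involutive c)) f)) λ ()
      disjoint′ d r h₁ h₂ | inj₂ (refl , _) | inj₂ (e , _) = not-¬ {not c} refl (sym e)

      closed′ : ∀ d → ¬ Collision (at O′ d) (κ d)
      closed′ d (p , q , p≢q , ap , aq , eq) with at⁻ O′ d p ap | at⁻ O′ d q aq
      ... | Pp , op | Pq , oq with O′⁻ d (ρ p) op | O′⁻ d (ρ q) oq
      ...   | inj₁ (refl , rp) | inj₁ (_ , rq) = none (p , q , p≢q , at⁺ R c p Pp rp , at⁺ R c q Pq rq , eq)
      ...   | inj₁ (refl , rp) | inj₂ rq =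
        none (p , q , p≢q , at⁺ R c p Pp rp , at⁺ R c q Pq (O⊆R _ _ rq) , eq)
      ...   | inj₂ rp | inj₁ (refl , rq) =
        none (p , q , p≢q , at⁺ R c p Pp (O⊆R _ _ rp) , at⁺ R c q Pq rq , eq)
      ...   | inj₂ rp | inj₂ rq = closed d (p , q , p≢q , at⁺ O d p Pp rp , at⁺ O d q Pq rq , eq)

      OK⇒OK′ : ∀ {e} → OK R O e → OK R′ O′ e
      OK⇒OK′ (source o) = source (O⊆O′ _ _ o)
      OK⇒OK′ (target r) = target (R⊆R′ _ _ r)

      derive′ : ∀ d r → R′ d r ≡ true → Forced R′ O′ (2 + k) d r
      derive′ d r h with R′⁻ d r h
      ... | inj₁ old = let forced es sz ok f = derive d r old in
                       forced es (≤-trans sz (m≤n+m k 2)) (All.map OK⇒OK′ ok) f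
      ... | inj₂ (refl , Rr , q , t , refl) with ∧-true⁻ (P q) _ t
      ...   | Pq , hit with enumerate 1 _ (⌊⌋-true⁻ (1 ≤? _) hit)
      ...     | e , _ , okp with fiber⁻ (at R c) (κ c) _ _ (okp zero)
      ...       | ap , eq with at⁻ R c (e zero) ap
      ...         | Pp , Rp = forced es (s≤s (s≤s sz)) oks forces
        where
        p = e zero
        open Forced (derive c (ρ p) Rp) renaming (size to sz; forces to forcesₚ)
        -- The root of `p` holds `c`, so the common child holds 1; if the root of `q` held `c` too,
        -- that child would hold 0.
        es = ((c , p) , true) ∷ ((c , q) , false) ∷ entries
        oks : All (OK R′ O′) es
        oks = source (R⊆O′ _ Rp) ∷ target (R′-new q Rr t) ∷ All.map OK⇒OK′ ok
        forces : ∀ x → x r₀ ≡ b₀ → All (Sat x) es → x (ρ q) ≡ not c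
        forces x x₀ (sp ∷ sq ∷ rest) = ¬-not λ xq →
          contradiction (trans (sym (sp (forcesₚ x x₀ rest))) (trans (cong x eq) (sq xq))) λ ()

      expand : State (2 + k)
      expand = record
        { R = R′ ; O = O′ ; O⊆R = O′⊆R′ ; disjoint = disjoint′ ; closed = closed′ ; derive = derive′ }

      -- Each source shares its child with more than `g` elements of `P`, itself included.
      -- Discounting the source leaves at least `g`, whose roots lie outside `R c` as there is no
      -- collision.
      growth : g * count (at R c) ≤ count (at R′ (not c))
      growth = +-cancelˡ-≤ (count (at R c)) _ _ (begin
        suc g * count (at R c)                         ≤⟨ fiber-growth (at R c) P (κ c) (suc g) none
                                                            (λ p ap → deg c p (proj₁ (at⁻ R c p ap))) ⟩
        count reached                                  ≤⟨ count-≤-+ reached (at R c) (at R′ (not c)) split ⟩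
        count (at R c) + count (at R′ (not c))         ∎)
        where
        open ≤-Reasoning
        split : ∀ q → reached q ≡ true → at R c q ≡ true ⊎ at R′ (not c) q ≡ true
        split q t with proj₁ (∧-true⁻ (P q) _ t) | false-or-true (R c (ρ q))
        ... | Pq | inj₁ f = inj₂ (at⁺ R′ (not c) q Pq (R′-new q f t))
        ... | Pq | inj₂ f = inj₁ (at⁺ R c q Pq f)

  -- `f` is the number of rounds left. A round trades a factor `g` of the power for a factor `g` of
  -- the count; at `f = 0` more than `s` sources must collide. A round lengthens derivations by 2
  -- and a collision uses two of them, hence the budget of 4 per round.
  refute-from : ∀ l f k c (S : State k) → 4 * f + (2 + (k + k)) ≤ l →
                s < g ^ f * count (at (State.R S) c) → Refuted l
  refute-from l f k c S fits big with collision? (at (State.R S) c) (κ c)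
  ... | yes coll = let es , size , rest = collision⇒refuted S c coll in
                   es , ≤-trans size (≤-trans (m≤n+m _ (4 * f)) fits) , rest
  refute-from l zero k c S fits big | no none =
    contradiction (no-collision⇒count≤ _ (κ c) none) (<⇒≱ (subst (s <_) (+-identityʳ _) big))
  refute-from l (suc f) k c S fits big | no none =
    refute-from l f (2 + k) (not c) expand
      (≤-trans (≤-reflexive (solve 2 (λ f k → con 4 :* f :+ (con 2 :+ ((con 2 :+ k) :+ (con 2 :+ k)))
                                          := con 4 :* (con 1 :+ f) :+ (con 2 :+ (k :+ k))) refl f k)) fits)
      (<-≤-trans big (begin
        g ^ suc f * count (at (State.R S) c)    ≡⟨ cong (_* count (at (State.R S) c)) (*-comm g (g ^ f)) ⟩
        g ^ f * g * count (at (State.R S) c)    ≡⟨ *-assoc (g ^ f) g _ ⟩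
        g ^ f * (g * count (at (State.R S) c))  ≤⟨ *-monoʳ-≤ (g ^ f) growth ⟩
        g ^ f * count (at R′ (not c))           ∎))
    where
    open Expand S c none
    open +-*-Solver
    open ≤-Reasoning

  initial : State 0
  initial = record
    { R = λ c r → ⌊ c ≟ᵇ b₀ ⌋ ∧ ⌊ r ≟ r₀ ⌋
    ; O = λ _ _ → false
    ; O⊆R = λ _ _ ()
    ; disjoint = λ c r h h′ → not-¬ {c} refl
        (trans (proj₁ (R⁻ c r h)) (sym (proj₁ (R⁻ (not c) r h′))))
    ; closed = λ { c (p , _ , _ , ap , _) → contradiction (proj₂ (at⁻ (λ _ _ → false) c p ap)) λ () }
    ; derive = λ c r h → forced [] z≤n [] λ x x₀ _ →
        trans (cong x (proj₂ (R⁻ c r h))) (trans x₀ (sym (proj₁ (R⁻ c r h))))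
    }
    where
    R⁻ : ∀ c r → ⌊ c ≟ᵇ b₀ ⌋ ∧ ⌊ r ≟ r₀ ⌋ ≡ true → c ≡ b₀ × r ≡ r₀
    R⁻ c r h with ∧-true⁻ ⌊ c ≟ᵇ b₀ ⌋ _ h
    ... | h₁ , h₂ = ⌊⌋-true⁻ (c ≟ᵇ b₀) h₁ , ⌊⌋-true⁻ (r ≟ r₀) h₂

  refute : ∀ k p → P p ≡ true → ρ p ≡ r₀ → s < g ^ k → Refuted (4 * k + 2)
  refute k p Pp eq big = refute-from (4 * k + 2) k 0 b₀ initial ≤-refl (<-≤-trans big
    (≤-trans (≤-reflexive (sym (*-identityʳ (g ^ k)))) (*-monoʳ-≤ (g ^ k) (begin
      1                          ≡⟨ sym (sum-delta true p) ⟩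
      count (λ q → ⌊ p ≟ q ⌋)    ≤⟨ count-mono _ (at (State.R initial) b₀) at-initial ⟩
      count (at (State.R initial) b₀) ∎))))
    where
    open ≤-Reasoning
    at-initial : ∀ q → ⌊ p ≟ q ⌋ ≡ true → at (State.R initial) b₀ q ≡ true
    at-initial q h with ⌊⌋-true⁻ (p ≟ q) h
    ... | refl = at⁺ (State.R initial) b₀ p Pp
                   (trans (cong (_∧ ⌊ ρ p ≟ r₀ ⌋) (⌊⌋-true⁺ (b₀ ≟ᵇ b₀) refl)) (⌊⌋-true⁺ (ρ p ≟ r₀) eq))

-- Refutations and their combination.

Answers : {I : Set} → (I → BitString s → Bool) → BitString s → I × Bool → Set
Answers F x (u , b) = F u x ≡ b

-- The predicate `X` confines the contradiction to some memories, such as those with a fixed value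
-- at a root; `X = ⊤` is what rules out a scheme.
record Refutation {I : Set} (F : I → BitString s → Bool) (k : ℕ) (X : BitString s → Set) : Set where
  constructor refutation
  field
    answers    : List (I × Bool)
    size       : length answers ≤ k
    functional : Functional answers
    unsat      : ∀ x → X x → ¬ All (Answers F x) answers

module _ {I J : Set} (F : I → BitString s → Bool) (e : Bool → J → I) (e-inj : JointlyInjective e)
         (X : Bool → BitString s → Set) (cover : ∀ x → ∃[ b ] X b x) where

  -- The two lists concern disjoint sets of queries, so their union stays functional, and every
  -- memory satisfies some `X b`, where list `b` already fails.
  merge : ∀ {k} → (∀ b → Refutation (F ∘ e b) k (X b)) → Refutation F (k + k) (λ _ → ⊤)
  merge {k} ref = refutation as size functional unsat
    where
    module R b = Refutation (ref b)
    part : Bool → List (I × Bool)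
    part b = map (map₁ (e b)) (R.answers b)
    as = part true ++ part false
    size : length as ≤ k + k
    size = ≤-trans (≤-reflexive (length-++ (part true)))
             (+-mono-≤ (≤-trans (≤-reflexive (length-map _ (R.answers true))) (R.size true))
                       (≤-trans (≤-reflexive (length-map _ (R.answers false))) (R.size false)))
    origin : ∀ {u c} → (u , c) ∈ as → ∃₂ λ b j → u ≡ e b j × (j , c) ∈ R.answers b
    origin u∈ with ∈-++⁻ (part true) u∈
    ... | inj₁ u∈₁ with ∈-map⁻ _ u∈₁
    ...   | (j , _) , j∈ , refl = true , j , refl , j∈
    origin u∈ | inj₂ u∈₂ with ∈-map⁻ _ u∈₂
    ...   | (j , _) , j∈ , refl = false , j , refl , j∈
    functional : Functional as
    functional u∈ u∈′ with origin u∈ | origin u∈′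
    ... | b , j , refl , j∈ | b′ , j′ , eq , j′∈ with e-inj b b′ j j′ eq
    ...   | refl , refl = R.functional b j∈ j′∈
    pull : ∀ x b → All (Answers F x) (part b) → All (Answers (F ∘ e b) x) (R.answers b)
    pull x b all = All.map⁻ all
    unsat : ∀ x → ⊤ → ¬ All (Answers F x) as
    unsat x _ all with cover x | All.++⁻ (part true) all
    ... | true  , Xx | all₁ , _ = R.unsat true  x Xx (pull x true all₁)
    ... | false , Xx | _ , all₂ = R.unsat false x Xx (pull x false all₂)

refutation-map : ∀ {I : Set} {F G : I → BitString s → Bool} {k l X Y} → (∀ x → Y x → X x) →
                 (∀ u x → Y x → G u x ≡ F u x) → k ≤ l → Refutation F k X → Refutation G l Y
refutation-map Y⊆X eq k≤l (refutation as size fun unsat) = refutation as (≤-trans size k≤l) fun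
  λ x Yx all → unsat x (Y⊆X x Yx) (All.map (λ {(u , b)} h → trans (sym (eq u x Yx)) h) all)

-- Complete decision trees, with exactly `t` probes on every path.

FullTree : ℕ → ℕ → Set
FullTree s zero    = Bool
FullTree s (suc t) = Fin s × (Bool → FullTree s t)

run : ∀ t → FullTree s t → BitString s → Bool
run zero    b       x = b
run (suc t) (r , f) x = run t (f (x r)) x

pad : Fin s → ∀ t (T : DTree s) → depth T ≤ t → FullTree s t
pad i₀ zero    (leaf b)     _       = b
-- A dummy probe of `i₀` with equal branches fills up a short path.
pad i₀ (suc t) (leaf b)     _       = i₀ , λ _ → pad i₀ t (leaf b) z≤n
pad i₀ (suc t) (node i l r) (s≤s h) = i , λ where
  false → pad i₀ t l (m⊔n≤o⇒m≤o (depth l) (depth r) h)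
  true  → pad i₀ t r (m⊔n≤o⇒n≤o (depth l) (depth r) h)

run-pad : ∀ (i₀ : Fin s) t T (h : depth T ≤ t) x → run t (pad i₀ t T h) x ≡ eval T x
run-pad i₀ zero    (leaf b)     h       x = refl
run-pad i₀ (suc t) (leaf b)     h       x = run-pad i₀ t (leaf b) z≤n x
run-pad i₀ (suc t) (node i l r) (s≤s h) x with x i
... | false = run-pad i₀ t l _ x
... | true  = run-pad i₀ t r _ x

-- Refuting large families of depth-two trees.

flip-forces : ∀ (f : Bool → Bool) β b → f b ≡ not (f (not β)) → b ≡ β
flip-forces f true  true  h = refl
flip-forces f false false h = refl
flip-forces f true  false h = contradiction h (not-¬ {f false} refl)
flip-forces f false true  h = contradiction h (not-¬ {f true} refl)

-- Two rounds of pairing read backwards: `s + 2N` trees give `N` pairs, and `N = s + 2k` pairs give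
-- `k` quadruples. Pruning `4 * s` vertices loses at most `4 * s * g` quadruples, so one survives.
depth-two-size : ℕ → ℕ → ℕ
depth-two-size s g = let k = suc (4 * s * g) in s + ((s + (k + k)) + (s + (k + k)))

length-cartesianProduct : ∀ {A B : Set} (xs : List A) (ys : List B) →
                          length (cartesianProduct xs ys) ≡ length xs * length ys
length-cartesianProduct []       ys = refl
length-cartesianProduct (x ∷ xs) ys = trans (length-++ (map (x ,_) ys) {cartesianProduct xs ys})
  (cong₂ _+_ (length-map (x ,_) ys) (length-cartesianProduct xs ys))

-- Pairs with a common root are paired again by that root. The index `σ` will separate the
-- refutations of the two root values, and `c` the two edges on which a tree is used.
quadruples : ∀ k (κ : Fin n → Fin s) → s + ((s + (k + k)) + (s + (k + k))) ≤ n →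
             Σ[ h ∈ (Bool → Bool × Fin k → Fin n) ] Σ[ ρ ∈ (Fin k → Fin s) ]
               JointlyInjective h × (∀ σ c p → κ (h σ (c , p)) ≡ ρ p)
quadruples {n} {s} k κ large
  with pairs (s + (k + k)) (λ _ → true) κ (≤-trans large (≤-reflexive (sym (count-true n))))
... | e , e-inj , _ , e-key
  with pairs k (λ _ → true) (κ ∘ e true) (≤-reflexive (sym (count-true (s + (k + k)))))
...   | e′ , e′-inj , _ , e′-key =
  (λ σ (c , p) → e c (e′ σ p)) , κ ∘ e true ∘ e′ true , inj , λ σ c p → trans (e-key c _) (e′-key σ p)
  where
  inj : JointlyInjective (λ σ (c , p) → e c (e′ σ p))
  inj σ σ′ (c , p) (c′ , p′) eq with e-inj c c′ _ _ eq
  ... | refl , eq′ with e′-inj σ σ′ p p′ eq′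
  ...   | refl , refl = refl , refl

module DepthTwo (T : Fin m → FullTree s 2) (N : ℕ) (h : Bool → Bool × Fin N → Fin m) (ρ : Fin N → Fin s)
                (root-h : ∀ σ c p → proj₁ (T (h σ (c , p))) ≡ ρ p) where

  child : Bool → Fin m → Fin s
  child c u = proj₁ (proj₂ (T u) c)

  answer : Bool → Fin m → Bool → Bool
  answer c u = proj₂ (proj₂ (T u) c)

  κ : Bool → Bool → Fin N → Fin s
  κ σ c p = child c (h σ (c , p))

  MinDegree : ℕ → (Fin N → Bool) → Set
  MinDegree g P = ∀ σ c p → P p ≡ true → g < count (fiber P (κ σ c) (κ σ c p))

  -- The pruned vertices are addresses tagged with `σ` and `c`. One `P` is dense for all four tags
  -- because both values of `σ` have to be refuted at the same root.
  dense-part : ∀ g → 4 * s * g < N → Σ[ P ∈ (Fin N → Bool) ] (∃[ p ] P p ≡ true) × MinDegree g P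
  dense-part g large
    with prune (λ (σ , c , y) p → ⌊ κ σ c p ≟ y ⌋) g (4 * s) vertices length-vertices
               (λ _ → true) (<-≤-trans large (≤-reflexive (sym (count-true N))))
    where
    bools : List Bool
    bools = true ∷ false ∷ []
    vertices : List (Bool × Bool × Fin s)
    vertices = cartesianProduct bools (cartesianProduct bools (allFin s))
    length-vertices : length vertices ≡ 4 * s
    length-vertices = begin
      length vertices                                 ≡⟨ length-cartesianProduct bools (cartesianProduct bools (allFin s)) ⟩
      2 * length (cartesianProduct bools (allFin s))  ≡⟨ cong (2 *_) (length-cartesianProduct bools (allFin s)) ⟩
      2 * (2 * length (allFin s))                     ≡⟨ cong (λ z → 2 * (2 * z)) (length-tabulate {n = s} id) ⟩
      2 * (2 * s)                                     ≡⟨ sym (*-assoc 2 2 s) ⟩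
      4 * s                                           ∎
      where open ≡-Reasoning
  ... | P , _ , nonempty , deg = P , nonempty , λ σ c p Pp →
    deg (σ , c , κ σ c p) p (∈-cartesianProduct⁺ (bool∈ σ) (∈-cartesianProduct⁺ (bool∈ c) (∈-allFin _)))
        Pp (⌊⌋-true⁺ (κ σ c p ≟ κ σ c p) refl)
    where
    bool∈ : ∀ b → b ∈ true ∷ false ∷ []
    bool∈ true  = here refl
    bool∈ false = there (here refl)

  -- The demanded answer is incompatible with the child holding not β (and cannot be given at all
  -- if the subtree below the c-edge is constant).
  demand : Bool → (Bool × Fin N) × Bool → (Bool × Fin N) × Bool
  demand σ ((c , p) , β) = (c , p) , not (answer c (h σ (c , p)) (not β))

  refute-side : ∀ g k P p₀ → P p₀ ≡ true → MinDegree g P → s < g ^ k → ∀ σ →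
                Refutation (run 2 ∘ T ∘ h σ) (4 * k + 2) (λ x → x (ρ p₀) ≡ σ)
  refute-side g k P p₀ Pp₀ deg big σ
    with Propagation.refute ρ (κ σ) P g (deg σ) (ρ p₀) σ k p₀ Pp₀ refl big
  ... | entries , size , functional , unsat =
    refutation (map (demand σ) entries)
      (≤-trans (≤-reflexive (length-map (demand σ) entries)) size) functional′
      λ x x₀ all → unsat x x₀ (All.map (λ {e} → satisfied x e) (All.map⁻ all))
    where
    open Propagation ρ (κ σ) P g (deg σ) (ρ p₀) σ using (Sat)
    functional′ : Functional (map (demand σ) entries)
    functional′ i j with ∈-map⁻ (demand σ) i | ∈-map⁻ (demand σ) j
    ... | ((c , p) , β) , i′ , refl | (_ , β′) , j′ , refl =
      cong (λ z → not (answer c (h σ (c , p)) (not z))) (functional i′ j′)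
    satisfied : ∀ x e → Answers (run 2 ∘ T ∘ h σ) x (demand σ e) → Sat x e
    -- If the root holds `c`, the tree reports `answer c u` of its child, and the demanded value
    -- differs from the one at `not β`.
    satisfied x ((c , p) , β) ans xρ = flip-forces (answer c u) β (x (child c u))
      (subst (λ z → answer z u (x (child z u)) ≡ not (answer c u (not β)))
             (trans (cong x (root-h σ c p)) xρ) ans)
      where u = h σ (c , p)

refute-depth-two : ∀ g k (T : Fin m → FullTree s 2) → depth-two-size s g ≤ m → s < g ^ k →
                   Refutation (run 2 ∘ T) ((4 * k + 2) + (4 * k + 2)) (λ _ → ⊤)
refute-depth-two {m} {s} g k T large big with quadruples (suc (4 * s * g)) (proj₁ ∘ T) large
... | h , ρ , h-inj , root-h with DepthTwo.dense-part T _ h ρ root-h g ≤-refl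
...   | P , (p₀ , Pp₀) , deg =
  merge (run 2 ∘ T) h h-inj (λ σ x → x (ρ p₀) ≡ σ) (λ x → x (ρ p₀) , refl)
        (DepthTwo.refute-side T _ h ρ root-h g k P p₀ Pp₀ deg big)

-- From depth two to arbitrary depth.

bool→fin : Bool → Fin 2
bool→fin false = zero
bool→fin true  = suc zero

bool→fin-injective : ∀ {a b} → bool→fin a ≡ bool→fin b → a ≡ b
bool→fin-injective {false} {false} _ = refl
bool→fin-injective {true}  {true}  _ = refl

-- An extra level costs a factor `s` for a popular root and a factor 2 for two disjoint halves, one
-- per root value; the number of answers doubles.
refute-depth : ∀ M c → .{{NonZero s}} →
  (∀ {m} (T : Fin m → FullTree s 2) → M ≤ m → Refutation (run 2 ∘ T) c (λ _ → ⊤)) →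
  ∀ j {m} (T : Fin m → FullTree s (2 + j)) → (2 * s) ^ j * M ≤ m →
  Refutation (run (2 + j) ∘ T) (2 ^ j * c) (λ _ → ⊤)
refute-depth M c base zero T large =
  refutation-map (λ _ → id) (λ _ _ _ → refl) (≤-reflexive (sym (+-identityʳ c)))
    (base T (≤-trans (≤-reflexive (sym (+-identityʳ M))) large))
refute-depth {s} M c base (suc j) {m} T large =
  refutation-map (λ _ → id) (λ _ _ _ → refl)
    (≤-reflexive (solve 2 (λ a c → a :* c :+ a :* c := (con 2 :* a) :* c) refl (2 ^ j) c))
    (merge (run (3 + j) ∘ T) e e-inj (λ b x → x r ≡ b) (λ x → x r , refl) side)
  where
  open +-*-Solver
  K = (2 * s) ^ j * M
  root : Fin m → Fin s
  root = proj₁ ∘ T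
  popular : ∃[ r ] 2 * K ≤ count (fiber (λ _ → true) root r)
  popular = large-fiber (2 * K) (λ _ → true) root (≤-trans (≤-reflexive
    (solve 3 (λ s a M → s :* (con 2 :* (a :* M)) := ((con 2 :* s) :* a) :* M) refl s ((2 * s) ^ j) M))
    (≤-trans large (≤-reflexive (sym (count-true m)))))
  r = proj₁ popular
  enum = enumerate (2 * K) _ (proj₂ popular)
  e : Bool → Fin K → Fin m
  e b i = proj₁ enum (combine (bool→fin b) i)
  e-inj : JointlyInjective e
  e-inj b b′ i i′ eq with combine-injective (bool→fin b) i (bool→fin b′) i′ (proj₁ (proj₂ enum) eq)
  ... | b≡ , i≡ = bool→fin-injective b≡ , i≡
  root-e : ∀ b i → root (e b i) ≡ r
  root-e b i = proj₂ (fiber⁻ (λ _ → true) root r (e b i) (proj₂ (proj₂ enum) (combine (bool→fin b) i)))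
  side : ∀ b → Refutation (run (3 + j) ∘ T ∘ e b) (2 ^ j * c) (λ x → x r ≡ b)
  -- Where `r` holds `b`, the trees of half `b` act as their `b`-subtrees, which are one level
  -- shallower.
  side b = refutation-map (λ _ _ → tt) step ≤-refl
             (refute-depth M c base j (λ i → proj₂ (T (e b i)) b) ≤-refl)
    where
    step : ∀ i x → x r ≡ b → run (3 + j) (T (e b i)) x ≡ run (2 + j) (proj₂ (T (e b i)) b) x
    step i x xr = cong (λ z → run (2 + j) (proj₂ (T (e b i)) z) x) (trans (cong x (root-e b i)) xr)

^-distribʳ-* : ∀ k a b → (a * b) ^ k ≡ a ^ k * b ^ k
^-distribʳ-* zero    a b = refl
^-distribʳ-* (suc k) a b = trans (cong (a * b *_) (^-distribʳ-* k a b))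
  (solve 4 (λ a b x y → a :* b :* (x :* y) := a :* x :* (b :* y)) refl a b (a ^ k) (b ^ k))
  where open +-*-Solver

-- Refutations against storing schemes.

∣p∪q∣≤∣p∣+∣q∣ : ∀ {n} (p q : Subset n) → ∣ p ∪ q ∣ ≤ ∣ p ∣ + ∣ q ∣
∣p∪q∣≤∣p∣+∣q∣ []          []          = z≤n
∣p∪q∣≤∣p∣+∣q∣ (true ∷ p)  (true ∷ q)  =
  s≤s (≤-trans (∣p∪q∣≤∣p∣+∣q∣ p q) (+-monoʳ-≤ ∣ p ∣ (n≤1+n ∣ q ∣)))
∣p∪q∣≤∣p∣+∣q∣ (true ∷ p)  (false ∷ q) = s≤s (∣p∪q∣≤∣p∣+∣q∣ p q)
∣p∪q∣≤∣p∣+∣q∣ (false ∷ p) (true ∷ q)  =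
  ≤-trans (s≤s (∣p∪q∣≤∣p∣+∣q∣ p q)) (≤-reflexive (sym (+-suc ∣ p ∣ ∣ q ∣)))
∣p∪q∣≤∣p∣+∣q∣ (false ∷ p) (false ∷ q) = ∣p∪q∣≤∣p∣+∣q∣ p q

module _ {m n s t : ℕ} (φ : StoringScheme m n s) (Q : QueryScheme m s t) (scheme : IsScheme φ Q) where

  open QueryScheme Q

  accepted : List (Fin m × Bool) → Subset m
  accepted []                 = ∅
  accepted ((u , true)  ∷ as) = ⁅ u ⁆ ∪ accepted as
  accepted ((u , false) ∷ as) = accepted as

  ∣accepted∣ : ∀ as → ∣ accepted as ∣ ≤ length as
  ∣accepted∣ []                 = ≤-reflexive (∣⊥∣≡0 m)
  ∣accepted∣ ((u , true)  ∷ as) = ≤-trans (∣p∪q∣≤∣p∣+∣q∣ ⁅ u ⁆ (accepted as))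
    (≤-trans (≤-reflexive (cong (_+ ∣ accepted as ∣) (∣⁅x⁆∣≡1 u))) (s≤s (∣accepted∣ as)))
  ∣accepted∣ ((u , false) ∷ as) = m≤n⇒m≤1+n (∣accepted∣ as)

  accepted⁺ : ∀ {u} as → (u , true) ∈ as → u ∈ₛ accepted as
  accepted⁺ ((u , true)  ∷ as) (here refl) = x∈p∪q⁺ (inj₁ (x∈⁅x⁆ u))
  accepted⁺ ((u , true)  ∷ as) (there u∈)  = x∈p∪q⁺ (inj₂ (accepted⁺ as u∈))
  accepted⁺ ((u , false) ∷ as) (there u∈)  = accepted⁺ as u∈

  accepted⁻ : ∀ {u} as → u ∈ₛ accepted as → (u , true) ∈ as
  accepted⁻ []                 u∈ = contradiction u∈ ∉⊥
  accepted⁻ ((v , true)  ∷ as) u∈ with x∈p∪q⁻ ⁅ v ⁆ (accepted as) u∈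
  ... | inj₁ u∈v with x∈⁅y⁆⇒x≡y v u∈v
  ...   | refl = here refl
  accepted⁻ ((v , true)  ∷ as) u∈ | inj₂ u∈as = there (accepted⁻ as u∈as)
  accepted⁻ ((v , false) ∷ as) u∈ = there (accepted⁻ as u∈)

  -- The memory storing the elements answered Yes gives every listed answer: a No element is outside
  -- this set by functionality.
  scheme-irrefutable : ∀ {k} → k ≤ n → ¬ Refutation (λ u → eval (tree u)) k (λ _ → ⊤)
  scheme-irrefutable k≤n (refutation as size functional unsat) =
    unsat (φ S small) tt (All.tabulate λ {(u , b)} → answer u b)
    where
    S = accepted as
    small : ∣ S ∣ ≤ n
    small = ≤-trans (∣accepted∣ as) (≤-trans size k≤n)
    answer : ∀ u b → (u , b) ∈ as → eval (tree u) (φ S small) ≡ b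
    answer u true  u∈ = Equivalence.from (scheme S small u) (accepted⁺ as u∈)
    answer u false u∈ = ¬-not λ yes! → contradiction
      (functional u∈ (accepted⁻ as (Equivalence.to (scheme S small u) yes!))) λ ()

eval-no-memory : (T : DTree 0) (x y : BitString 0) → eval T x ≡ eval T y
eval-no-memory (leaf b) x y = refl

-- Trees without addresses are constant, so the empty set and a singleton cannot be told apart.
no-memory : ∀ {t} (φ : StoringScheme (suc m) (suc n) 0) (Q : QueryScheme (suc m) 0 t) → ¬ IsScheme φ Q
no-memory {m} {n} φ Q scheme = contradiction
  (Equivalence.to (scheme ∅ small₀ zero)
    (trans (eval-no-memory (QueryScheme.tree Q zero) (φ ∅ small₀) (φ ⁅ zero ⁆ small₁)) (Equivalence.from (scheme ⁅ zero ⁆ small₁ zero) (x∈⁅x⁆ (zero {m}))))) ∉⊥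
  where
  small₀ : ∣ ∅ {suc m} ∣ ≤ suc n
  small₀ = ≤-trans (≤-reflexive (∣⊥∣≡0 m)) z≤n
  small₁ : ∣ ⁅ zero {m} ⁆ ∣ ≤ suc n
  small₁ = ≤-trans (≤-reflexive (∣⁅x⁆∣≡1 (zero {m}))) (s≤s z≤n)

-- Integer roots and the choice of parameters.

integer-root : ∀ k s → .{{NonZero k}} → ∃[ h ] h ^ k ≤ s × s < suc h ^ k
integer-root k@(suc _) zero = 0 , z≤n , m^n>0 1 k
integer-root k (suc s) with integer-root k s
... | h , low , high with suc s <? suc h ^ k
...   | yes still = h , m≤n⇒m≤1+n low , still
-- From `s` to `s + 1` the root grows by at most one.
...   | no  over  = suc h , ≮⇒≥ over , <-≤-trans (s≤s high) (^-monoˡ-< k (n<1+n (suc h)))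

^-cancelʳ-≤ : ∀ {a b} k → .{{NonZero k}} → a ^ k ≤ b ^ k → a ≤ b
^-cancelʳ-≤ k le = ≮⇒≥ λ b<a → <⇒≱ (^-monoˡ-< k b<a) le

-- After raising to the power `k + 1`, only `(n - q)(k + 1) ≤ k n` is left, that is
-- `1 - q/n ≤ k/(k + 1)`, which is the hypothesis on `n` rearranged.
^-interpolate : ∀ {m B q n k} → .{{NonZero m}} → m ^ k ≤ B ^ suc k → n ≤ q * suc k → m ^ (n ∸ q) ≤ B ^ n
^-interpolate {m} {B} {q} {n} {k} le n≤ = ^-cancelʳ-≤ (suc k) (begin
  (m ^ (n ∸ q)) ^ suc k      ≡⟨ ^-*-assoc m (n ∸ q) (suc k) ⟩
  m ^ ((n ∸ q) * suc k)      ≤⟨ ^-monoʳ-≤ m exponents ⟩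
  m ^ (k * n)                ≡⟨ sym (^-*-assoc m k n) ⟩
  (m ^ k) ^ n                ≤⟨ ^-monoˡ-≤ n le ⟩
  (B ^ suc k) ^ n            ≡⟨ ^-*-assoc B (suc k) n ⟩
  B ^ (suc k * n)            ≡⟨ cong (B ^_) (*-comm (suc k) n) ⟩
  B ^ (n * suc k)            ≡⟨ sym (^-*-assoc B n (suc k)) ⟩
  (B ^ n) ^ suc k            ∎)
  where
  open ≤-Reasoning
  exponents : (n ∸ q) * suc k ≤ k * n
  exponents = begin
    (n ∸ q) * suc k          ≡⟨ *-distribʳ-∸ (suc k) n q ⟩
    n * suc k ∸ q * suc k    ≤⟨ ∸-monoʳ-≤ (n * suc k) n≤ ⟩
    n * suc k ∸ n            ≡⟨ cong (_∸ n) (*-comm n (suc k)) ⟩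
    n + k * n ∸ n            ≡⟨ m+n∸m≡n n (k * n) ⟩
    k * n                    ∎

depth-two-size≤ : ∀ s h → .{{NonZero s}} → .{{NonZero h}} → depth-two-size s (suc h) ≤ 39 * (s * h)
depth-two-size≤ s@(suc s′) h@(suc h′) = begin
  depth-two-size s (suc h)
    -- The size is `16 s h + 19 s + 4`, and 16 + 19 + 4 = 39; the added term is the exact slack.
    ≤⟨ m≤m+n _ (23 * (s * h′) + 4 * s′) ⟩
  depth-two-size s (suc h) + (23 * (s * h′) + 4 * s′)
    ≡⟨ solve 2 (λ s h →
         let S = con 1 :+ s
             k = con 1 :+ con 4 :* S :* (con 2 :+ h)
             N = S :+ (k :+ k)
         in S :+ (N :+ N) :+ (con 23 :* (S :* h) :+ con 4 :* s) := con 39 :* (S :* (con 1 :+ h)))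
         refl s′ h′ ⟩
  39 * (s * h) ∎
  where
  open ≤-Reasoning
  open +-*-Solver

-- Source of the constant 15: two of the factors `15 * s` absorb 2 * 39 = 78 ≤ 225, and each of the
-- others absorbs a 2.
universe-size≤ : ∀ i s h → .{{NonZero s}} → .{{NonZero h}} →
                 (2 * s) ^ suc i * depth-two-size s (suc h) ≤ (15 * s) ^ (2 + i) * h
universe-size≤ i s h = begin
  (2 * s) ^ suc i * depth-two-size s (suc h)      ≤⟨ *-monoʳ-≤ ((2 * s) ^ suc i) (depth-two-size≤ s h) ⟩
  (2 * s) ^ suc i * (39 * (s * h))                ≡⟨ solve 3 (λ a s h → ((con 2 :* s) :* a) :* (con 39 :* (s :* h))
                                                       := a :* (con 78 :* (s :* s :* h))) refl ((2 * s) ^ i) s h ⟩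
  (2 * s) ^ i * (78 * (s * s * h))                ≤⟨ *-mono-≤ (^-monoˡ-≤ i (*-monoˡ-≤ s (m≤m+n 2 13)))
                                                              (*-monoˡ-≤ (s * s * h) (m≤m+n 78 147)) ⟩
  (15 * s) ^ i * (225 * (s * s * h))              ≡⟨ solve 3 (λ a s h → a :* (con 225 :* (s :* s :* h))
                                                       := ((con 15 :* s) :* ((con 15 :* s) :* a)) :* h)
                                                       refl ((15 * s) ^ i) s h ⟩
  (15 * s) ^ (2 + i) * h                          ∎
  where
  open ≤-Reasoning
  open +-*-Solver

-- For `k ≥ 1` one has `8k + 4 ≤ 16k`; the remaining `2 ^ j` is below `4 ^ j`.
refutation-cost≤ : ∀ j k → .{{NonZero k}} → 2 ^ j * ((4 * k + 2) + (4 * k + 2)) ≤ k * 4 ^ (2 + j)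
refutation-cost≤ j k@(suc k′) = begin
  2 ^ j * ((4 * k + 2) + (4 * k + 2))    ≤⟨ *-mono-≤ (^-monoˡ-≤ j (m≤m+n 2 2)) (m≤m+n _ (8 * k′ + 4)) ⟩
  4 ^ j * ((4 * k + 2) + (4 * k + 2) + (8 * k′ + 4))
    ≡⟨ solve 2 (λ a k → let K = con 4 :* (con 1 :+ k) :+ con 2 in
                 a :* (K :+ K :+ (con 8 :* k :+ con 4)) := (con 1 :+ k) :* (con 4 :* (con 4 :* a)))
               refl (4 ^ j) k′ ⟩
  k * 4 ^ (2 + j)                        ∎
  where
  open ≤-Reasoning
  open +-*-Solver

-- The bound raised to the power `(t - 1) n`, which clears the real exponent. It holds for every `s`
-- admitting a scheme, hence for the minimum.
theorem6 : (m n s t : ℕ) → 1 ≤ m → 3 ≤ t → 4 ^ t ≤ n →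
    (φ : StoringScheme m n s) (Q : QueryScheme m s t) → IsScheme φ Q →
    m ^ (n ∸ 4 ^ t) ≤ (15 * s) ^ ((t ∸ 1) * n)
theorem6 (suc m′) zero 0 t _ _ 4^t≤n _ _ _ = contradiction 4^t≤n (<⇒≱ (m^n>0 4 t))
theorem6 (suc m′) (suc n′) 0 t _ _ _ φ Q scheme = contradiction scheme (no-memory φ Q)
theorem6 m@(suc _) n s@(suc _) t@(suc (suc j@(suc i))) _ (s≤s (s≤s (s≤s z≤n))) 4^t≤n φ Q scheme =
  ≤-trans (^-interpolate {m} {B} {4 ^ t} {n} {k} m^k≤ n≤) (≤-reflexive (^-*-assoc (15 * s) (suc j) n))
  where
  open QueryScheme Q
  instance
    4^t≢0 : NonZero (4 ^ t)
    4^t≢0 = m^n≢0 4 t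
  -- The largest number of rounds for which the bound `k * 4 ^ t` on the answers stays within `n`.
  k = n / 4 ^ t
  instance
    k≢0 : NonZero k
    k≢0 = >-nonZero (m≥n⇒m/n>0 4^t≤n)
  B = (15 * s) ^ suc j
  -- The rounded-down `k`-th root of `s`; the degree used is `h + 1`, the least `g` with
  -- `s < g ^ k`.
  h   = proj₁ (integer-root k s)
  h^k≤s = proj₁ (proj₂ (integer-root k s))
  s<g^k = proj₂ (proj₂ (integer-root k s))
  instance
    h≢0 : NonZero h
    h≢0 = ≢-nonZero λ h≡0 → contradiction
      (subst (s <_) (trans (cong (λ z → suc z ^ k) h≡0) (^-zeroˡ k)) s<g^k) (≤⇒≯ (s≤s z≤n))
  n≤ : n ≤ 4 ^ t * suc k
  n≤ = begin
    n                             ≡⟨ m≡m%n+[m/n]*n n (4 ^ t) ⟩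
    n % 4 ^ t + k * 4 ^ t         ≤⟨ +-monoˡ-≤ (k * 4 ^ t) (m%n≤n n (4 ^ t)) ⟩
    suc k * 4 ^ t                 ≡⟨ *-comm (suc k) (4 ^ t) ⟩
    4 ^ t * suc k                 ∎
    where open ≤-Reasoning
  T : Fin m → FullTree s t
  T u = pad zero t (tree u) (depth-≤ u)
  refuted : (2 * s) ^ j * depth-two-size s (suc h) ≤ m → Refutation (λ u → eval (tree u)) _ (λ _ → ⊤)
  refuted large = refutation-map (λ _ → id) (λ u x _ → sym (run-pad zero t (tree u) (depth-≤ u) x)) ≤-refl
    (refute-depth _ _ (λ T₂ large₂ → refute-depth-two (suc h) k T₂ large₂ s<g^k) j T large)
  small : m ≤ B * h
  small = ≤-trans (<⇒≤ (≰⇒> λ large → scheme-irrefutable φ Q scheme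
            (≤-trans (refutation-cost≤ j k) (m/n*n≤m n (4 ^ t))) (refuted large)))
          (universe-size≤ i s h)
  s≤B : s ≤ B
  s≤B = ≤-trans (m≤n*m s 15) (m≤m*n (15 * s) ((15 * s) ^ j) {{m^n≢0 (15 * s) j}})
  m^k≤ : m ^ k ≤ B ^ suc k
  m^k≤ = begin
    m ^ k             ≤⟨ ^-monoˡ-≤ k small ⟩
    (B * h) ^ k       ≡⟨ ^-distribʳ-* k B h ⟩
    -- The factor `h ^ k ≤ s` is absorbed by one more `B`, which yields the exponent `k/(k + 1)`.
    B ^ k * h ^ k     ≤⟨ *-monoʳ-≤ (B ^ k) (≤-trans h^k≤s s≤B) ⟩
    B ^ k * B         ≡⟨ *-comm (B ^ k) B ⟩
    B ^ suc k         ∎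
    where open ≤-Reasoning
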